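{- Let $p,k,n$ be integers with $p\ge 4$, $0\le k\le p-1$, $n\ge p+1$, and $n\equiv k\pmod{p}$. Then $$\mathrm{sat}(n, K_1\vee(K_{p-1}\cup K_1))=\frac{(p-1)n}{2}+\frac{k(k-p)}{2}.$$ Furthermore, $\mathrm{SAT}(n, K_1\vee(K_{p-1}\cup K_1))=\{\lfloor\frac{n}{p}\rfloor K_p\cup K_k\}$; that is, up to isomorphism the unique extremal graph is the disjoint union of $\lfloor n/p\rfloor$ copies of $K_p$ and one copy of $K_k$.
   Context: All graphs are finite and simple. For graphs $F$ and $G$, $G$ is $F$-saturated if $G$ contains no copy of $F$ as a (not necessarily induced) subgraph, but for every edge $e$ of the complement $\overline{G}$, the graph $G+e$ obtained by adding $e$ to $G$ contains a copy of $F$. The saturation number $\mathrm{sat}(n,F)$ is the minimum number of edges in an $F$-saturated graph on $n$ vertices, and $\mathrm{SAT}(n,F)$ is the set (up to isomorphism) of $F$-saturated graphs on $n$ vertices with exactly $\mathrm{sat}(n,F)$ edges. $K_m$ is the complete graph on $m$ vertices ($K_0$ is the graph with no vertices), $\cup$ denotes vertex-disjoint union, $mG$ denotes the disjoint union of $m$ copies of $G$, and $G_1\vee G_2$ is the join, obtained from the disjoint union $G_1\cup G_2$ by adding all edges between $V(G_1)$ and $V(G_2)$. -}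

module Defs where

open import Data.Bool using (Bool; true; false; T; not)
import Data.Bool as Bool
open import Data.Bool.Properties using (∨-comm; ∧-comm)
open import Data.Fin using (Fin; splitAt; _<_)
open import Data.Fin.Properties using (_≟_; _<?_)
open import Data.List using (List; allFin; cartesianProduct; filter; length)
open import Data.Nat using (ℕ; zero; suc; _+_; _*_; _≤_)
open import Data.Product using (_×_; _,_; Σ-syntax; ∃-syntax)
open import Data.Sum using (_⊎_; inj₁; inj₂)
open import Function using (_↔_; Inverse; Injective)
open import Level using (0ℓ)
open import Relation.Binary.PropositionalEquality
  using (_≡_; _≢_; refl; sym; trans; cong; cong₂; subst)
open import Relation.Nullary using (¬_; yes; no; ⌊_⌋; contradiction; T?; _×-dec_)
open import Relation.Unary using (Pred)

private variable
  m n : ℕ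

record Graph (n : ℕ) : Set where
  field
    adj        : Fin n → Fin n → Bool
    adj-sym    : ∀ u v → adj u v ≡ adj v u
    adj-irrefl : ∀ v → adj v v ≡ false

open Graph public

Adj : Graph n → Fin n → Fin n → Set
Adj G u v = T (adj G u v)

Adj⇒≢ : (G : Graph n) {u v : Fin n} → Adj G u v → u ≢ v
Adj⇒≢ G {u} a refl = subst T (adj-irrefl G u) a

-- Each edge is listed once, with its smaller endpoint first.
edges : Graph n → List (Fin n × Fin n)
edges {n} G =
  filter (λ (u , v) → (u <? v) ×-dec T? (adj G u v))
         (cartesianProduct (allFin n) (allFin n))

size : Graph n → ℕ
size G = length (edges G)

infix 4 _≅_

_≅_ : Graph m → Graph n → Set
_≅_ {m} {n} G H =
  Σ[ φ ∈ Fin m ↔ Fin n ]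
    (∀ u v → adj G u v ≡ adj H (Inverse.to φ u) (Inverse.to φ v))

Contains : Graph n → Graph m → Set
Contains {n} {m} G F =
  Σ[ f ∈ (Fin m → Fin n) ]
    (Injective _≡_ _≡_ f × (∀ u v → Adj F u v → Adj G (f u) (f v)))

≟-sym : (u v : Fin n) → ⌊ u ≟ v ⌋ ≡ ⌊ v ≟ u ⌋
≟-sym u v with u ≟ v | v ≟ u
... | yes _ | yes _ = refl
... | no  _ | no  _ = refl
... | yes p | no ¬q = contradiction (sym p) ¬q
... | no ¬p | yes q = contradiction (sym q) ¬p

≟-refl : (v : Fin n) → ⌊ v ≟ v ⌋ ≡ true
≟-refl v with v ≟ v
... | yes _ = refl
... | no ¬p = contradiction refl ¬p

K : (m : ℕ) → Graph m
K m .adj u v      = not ⌊ u ≟ v ⌋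
K m .adj-sym u v  = cong not (≟-sym u v)
K m .adj-irrefl v = cong not (≟-refl v)

complement : Graph n → Graph n
complement G .adj u v      = not (adj G u v) Bool.∧ not ⌊ u ≟ v ⌋
complement G .adj-sym u v  =
  cong₂ Bool._∧_ (cong not (adj-sym G u v)) (cong not (≟-sym u v))
complement G .adj-irrefl v =
  cong₂ (λ a b → not a Bool.∧ not b) (adj-irrefl G v) (≟-refl v)

addEdge : (G : Graph n) (u v : Fin n) → u ≢ v → Graph n
addEdge G u v _ .adj x y =
  adj G x y Bool.∨ ((⌊ x ≟ u ⌋ Bool.∧ ⌊ y ≟ v ⌋) Bool.∨ (⌊ x ≟ v ⌋ Bool.∧ ⌊ y ≟ u ⌋))
addEdge G u v _ .adj-sym x y =
  cong₂ Bool._∨_ (adj-sym G x y)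
    (trans (∨-comm (⌊ x ≟ u ⌋ Bool.∧ ⌊ y ≟ v ⌋) _)
      (cong₂ Bool._∨_ (∧-comm ⌊ x ≟ v ⌋ _) (∧-comm ⌊ x ≟ u ⌋ _)))
addEdge G u v u≢v .adj-irrefl x rewrite adj-irrefl G x with x ≟ u | x ≟ v
... | yes p | yes q = contradiction (trans (sym p) q) u≢v
... | yes _ | no  _ = refl
... | no  _ | yes _ = refl
... | no  _ | no  _ = refl

-- The common part of disjoint union and join: the vertices of G come first,
-- and c says whether every vertex of G is adjacent to every vertex of H.
module _ (c : Bool) (G : Graph m) (H : Graph n) where
  sumAdj : Fin m ⊎ Fin n → Fin m ⊎ Fin n → Bool
  sumAdj (inj₁ u) (inj₁ v) = adj G u v
  sumAdj (inj₁ _) (inj₂ _) = c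
  sumAdj (inj₂ _) (inj₁ _) = c
  sumAdj (inj₂ u) (inj₂ v) = adj H u v

  sumAdj-sym : ∀ x y → sumAdj x y ≡ sumAdj y x
  sumAdj-sym (inj₁ u) (inj₁ v) = adj-sym G u v
  sumAdj-sym (inj₁ _) (inj₂ _) = refl
  sumAdj-sym (inj₂ _) (inj₁ _) = refl
  sumAdj-sym (inj₂ u) (inj₂ v) = adj-sym H u v

  sumAdj-irrefl : ∀ x → sumAdj x x ≡ false
  sumAdj-irrefl (inj₁ u) = adj-irrefl G u
  sumAdj-irrefl (inj₂ v) = adj-irrefl H v

  glue : Graph (m + n)
  glue .adj u v      = sumAdj (splitAt m u) (splitAt m v)
  glue .adj-sym u v  = sumAdj-sym (splitAt m u) (splitAt m v)
  glue .adj-irrefl v = sumAdj-irrefl (splitAt m v)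

infixr 6 _∪_ _∨_

_∪_ : Graph m → Graph n → Graph (m + n)
G ∪ H = glue false G H

_∨_ : Graph m → Graph n → Graph (m + n)
G ∨ H = glue true G H

infixr 7 _·_

_·_ : (q : ℕ) → Graph n → Graph (q * n)
zero  · G = K 0
suc q · G = G ∪ (q · G)

Saturated : Graph m → Graph n → Set
Saturated F G =
  (¬ Contains G F) ×
  (∀ u v (e : Adj (complement G) u v) →
     Contains (addEdge G u v (Adj⇒≢ (complement G) e)) F)

-- "sat(n, F) = s".  A relation rather than a function, because for an edgeless
-- F there need not be any F-saturated graph on n vertices.
IsSat : (n : ℕ) → Graph m → ℕ → Set
IsSat n F s =
  (∃[ G ] (Saturated {n = n} F G × size G ≡ s)) ×
  (∀ (G : Graph n) → Saturated F G → s ≤ size G)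

SAT : (n : ℕ) → Graph m → Pred (Graph n) 0ℓ
SAT n F G = Saturated F G × IsSat n F (size G)

{-# OPTIONS --safe #-}
module Submission where

-- Let F be K_p with a pendant edge and G be F-saturated.  Every K_p in G is a
-- component, so the copies of K_p can be peeled off one at a time.  Adding an
-- edge uv to the remainder H creates a copy of F whose K_p uses uv, so two
-- nonadjacent vertices of H have p − 2 pairwise adjacent common neighbours and
-- |H| > p.  If H is complete, then H = K_k.  Otherwise all degrees in H are at
-- least p − 2.  A vertex of degree exactly p − 2 forces its whole neighbourhood
-- to be joined to everything, and if all degrees are at least p − 1, then H is
-- not (p − 1)-regular; either way the degree sum strictly exceeds the one of
-- the disjoint union of cliques.

open import Defs
open import Data.Bool using (Bool; true; false; T; if_then_else_)
import Data.Bool as Bool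
open import Data.Bool.Properties using (T-∨; T-≡)
open import Data.Empty using (⊥; ⊥-elim)
open import Data.Fin using (Fin; zero; suc; _↑ˡ_; _↑ʳ_; splitAt; join; punchIn; punchOut; inject≤)
open import Data.Fin.Permutation as Perm using (Permutation; _⟨$⟩ʳ_; _⟨$⟩ˡ_)
open import Data.Fin.Properties as Fin using (_≟_; _<?_; any?; +↔⊎; splitAt-↑ˡ; splitAt-↑ʳ)
open import Data.Integer as ℤ using (ℤ; +_)
import Data.Integer.Properties as ℤ
import Data.Integer.Tactic.RingSolver as ℤSolver
import Data.List as List
open import Data.List using (cartesianProduct; filter; length; tabulate)
open import Data.List.Properties using (filter-++; length-++; map-tabulate)
open import Data.Nat as ℕ
  using (ℕ; zero; suc; pred; _+_; _*_; _∸_; _≤_; _<_; z≤n; s≤s; NonZero)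
open import Data.Nat.DivMod using (_%_; m≡m%n+[m/n]*n; m<n⇒m%n≡m)
import Data.Nat.Properties as ℕ
import Data.Nat.Tactic.RingSolver as ℕSolver
open import Data.Product using (_×_; _,_; proj₁; proj₂; ∃-syntax; Σ-syntax)
open import Data.Rational as ℚ using ()
import Data.Rational.Properties as ℚ
import Data.Rational.Unnormalised as ℚᵘ
import Data.Rational.Unnormalised.Properties as ℚᵘ
open import Data.Sum as ⊎ using (_⊎_; inj₁; inj₂; [_,_]′)
open import Data.Sum.Algebra using (⊎-assoc)
open import Data.Sum.Function.Propositional using (_⊎-↔_)
open import Data.Unit using (tt)
open import Data.Vec.Functional using (_∷_)
open import Function using (_∘_; id; Injective; Inverse; Equivalence; _⇔_; mk⇔)
open import Function.Construct.Composition using (_↔-∘_)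
open import Function.Construct.Identity using (↔-id)
open import Function.Construct.Symmetry using (↔-sym)
open import Level using (0ℓ)
open import Relation.Binary.Definitions using (tri<; tri≈; tri>)
open import Relation.Binary.PropositionalEquality
open import Relation.Nullary using (¬_; yes; no; does; contradiction; _×-dec_; T?)
open import Relation.Nullary.Decidable using (dec-true; dec-false)
open import Relation.Unary using (Pred; Decidable; _∈_)

open import Algebra.Properties.Semiring.Sum ℕ.+-*-semiring
  using (sum; sum-syntax; sum-cong-≗; sum-permute; ∑-distrib-+; ∑-comm; *-distribʳ-sum)

-- The competitor to keep out is K_p minus an edge: it contains no K_p, its two nonadjacent vertices
-- have p - 2 pairwise adjacent common neighbours, and it has fewer edges than K_p. Only the pendant
-- vertex of F excludes it. This is why the leaf is carried along when cliques are removed: it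
-- supplies |H| > p and, in the regular case, a vertex outside the neighbourhood of a common
-- neighbour. The assumption p ≥ 4 enters as p - 2 ≥ 2: the regular case compares two adjacent
-- common neighbours. For p = 3 the five-cycle would be a regular remainder. All counting is done
-- with degree sums, twice the number of edges, so nothing is halved before the closed formula. The
-- alternative "isomorphic or strictly larger" yields the minimum and the uniqueness together.

private variable
  a b c k m n : ℕ

-- Finite sums and injections

∑-mono : {f g : Fin n → ℕ} → (∀ i → f i ≤ g i) → sum f ≤ sum g
∑-mono {zero}  f≤g = z≤n
∑-mono {suc n} f≤g = ℕ.+-mono-≤ (f≤g zero) (∑-mono (f≤g ∘ suc))

∑-mono-< : {f g : Fin n → ℕ} → (∀ i → f i ≤ g i) → (i : Fin n) → f i < g i → sum f < sum g
∑-mono-< f≤g zero    f<g = ℕ.+-mono-<-≤ f<g (∑-mono (f≤g ∘ suc))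
∑-mono-< f≤g (suc i) f<g = ℕ.+-mono-≤-< (f≤g zero) (∑-mono-< (f≤g ∘ suc) i f<g)

∑-const : ∀ n c → ∑[ i < n ] c ≡ n * c
∑-const zero    c = refl
∑-const (suc n) c = cong (λ z → c + z) (∑-const n c)

∑-splitAt : ∀ a (f : Fin (a + b) → ℕ) →
            sum f ≡ ∑[ i < a ] f (i ↑ˡ b) + ∑[ j < b ] f (a ↑ʳ j)
∑-splitAt zero    f = refl
∑-splitAt (suc a) f = trans (cong (λ z → f zero + z) (∑-splitAt a (f ∘ suc))) (sym (ℕ.+-assoc (f zero) _ _))

-- Renumbers the vertices so that the image of `g` comes first and its complement becomes `Fin b`.
-- In the induction, `punchOut` removes `g zero` from the codomain and `Perm.insert` puts it back.
extendInjection : (g : Fin a → Fin n) → Injective _≡_ _≡_ g →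
                  ∃[ b ] Σ[ π ∈ Permutation (a + b) n ] (∀ i → π ⟨$⟩ʳ (i ↑ˡ b) ≡ g i)
extendInjection {zero}          g inj = _ , Perm.id , λ ()
extendInjection {suc a} {zero}  g inj = ⊥-elim (Fin.¬Fin0 (g zero))
extendInjection {suc a} {suc n} g inj
  with b , π , π-ext ← extendInjection (λ i → punchOut {i = g zero} {g (suc i)} (Fin.0≢1+n ∘ inj))
                         (λ eq → Fin.suc-injective (inj
                           (Fin.punchOut-injective (Fin.0≢1+n ∘ inj) (Fin.0≢1+n ∘ inj) eq)))
  = b , Perm.insert zero (g zero) π , λ where
      zero    → refl
      (suc i) → trans (Perm.insert-punchIn zero (g zero) π (i ↑ˡ b))
                  (trans (cong (punchIn (g zero)) (π-ext i)) (Fin.punchIn-punchOut _))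

⟦_⟧ : Bool → ℕ
⟦ x ⟧ = if x then 1 else 0

T⇒1≤⟦⟧ : ∀ {x} → T x → 1 ≤ ⟦ x ⟧
T⇒1≤⟦⟧ {true} _ = s≤s z≤n

injection⇒≤∑ : (g : Fin a → Fin n) → Injective _≡_ _≡_ g →
               (f : Fin n → Bool) → (∀ i → T (f (g i))) → a ≤ ∑[ x < n ] ⟦ f x ⟧
injection⇒≤∑ {a} {n} g inj f Tfg with b , π , π-ext ← extendInjection g inj = begin
  a                                                  ≡⟨ ℕ.*-identityʳ a ⟨
  a * 1                                              ≡⟨ ∑-const a 1 ⟨
  ∑[ i < a ] 1                                       ≤⟨ ∑-mono (λ i → T⇒1≤⟦⟧ (subst (T ∘ f) (sym (π-ext i)) (Tfg i))) ⟩
  ∑[ i < a ] ⟦ f (π ⟨$⟩ʳ (i ↑ˡ b)) ⟧                 ≤⟨ ℕ.m≤m+n _ _ ⟩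
  ∑[ i < a ] ⟦ f (π ⟨$⟩ʳ (i ↑ˡ b)) ⟧ + _             ≡⟨ ∑-splitAt a _ ⟨
  ∑[ i < a + b ] ⟦ f (π ⟨$⟩ʳ i) ⟧                    ≡⟨ sum-permute (⟦_⟧ ∘ f) π ⟨
  ∑[ x < n ] ⟦ f x ⟧                                 ∎
  where open ℕ.≤-Reasoning

-- Degree sums

degree : Graph n → Fin n → ℕ
degree {n} G v = ∑[ w < n ] ⟦ adj G v w ⟧

degreeSum : Graph n → ℕ
degreeSum G = sum (degree G)

length-filter-tabulate : {A : Set} {P : Pred A 0ℓ} (P? : Decidable P) (f : Fin n → A) →
                         length (filter P? (tabulate f)) ≡ ∑[ i < n ] ⟦ does (P? (f i)) ⟧
length-filter-tabulate {zero}  P? f = refl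
length-filter-tabulate {suc n} P? f with does (P? (f zero))
... | true  = cong suc (length-filter-tabulate P? (f ∘ suc))
... | false = length-filter-tabulate P? (f ∘ suc)

length-filter-product : {A B : Set} {P : Pred (A × B) 0ℓ} (P? : Decidable P)
                        (f : Fin m → A) (g : Fin n → B) →
                        length (filter P? (cartesianProduct (tabulate f) (tabulate g))) ≡
                        ∑[ i < m ] ∑[ j < n ] ⟦ does (P? (f i , g j)) ⟧
length-filter-product {zero}  P? f g = refl
length-filter-product {suc m} P? f g = trans (cong length (filter-++ P? (List.map (f zero ,_) (tabulate g)) _))
  (trans (length-++ (filter P? (List.map (f zero ,_) (tabulate g))))
    (cong₂ _+_
      (trans (cong (length ∘ filter P?) (map-tabulate g (f zero ,_)))
             (length-filter-tabulate P? (λ j → f zero , g j)))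
      (length-filter-product P? (f ∘ suc) g)))

-- Edges are counted as pairs u < v. Transposing the double sum in the second copy counts pairs v <
-- u instead, and the two indicators add up to adjacency at every pair.
handshake : (G : Graph n) → size G + size G ≡ degreeSum G
handshake {n} G = begin
  size G + size G
    ≡⟨ cong₂ _+_ size≡ (trans size≡ (∑-comm (λ u v → ⟦ up u v ⟧))) ⟩
  ∑[ u < n ] ∑[ v < n ] ⟦ up u v ⟧ + ∑[ u < n ] ∑[ v < n ] ⟦ up v u ⟧
    ≡⟨ ∑-distrib-+ (λ u → ∑[ v < n ] ⟦ up u v ⟧) _ ⟨
  ∑[ u < n ] (∑[ v < n ] ⟦ up u v ⟧ + ∑[ v < n ] ⟦ up v u ⟧)
    ≡⟨ sum-cong-≗ (λ u → trans (sym (∑-distrib-+ (λ v → ⟦ up u v ⟧) _)) (sum-cong-≗ (orient u))) ⟩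
  degreeSum G ∎
  where
  open ≡-Reasoning

  up : Fin n → Fin n → Bool
  up u v = does (u <? v) Bool.∧ adj G u v

  size≡ : size G ≡ ∑[ u < n ] ∑[ v < n ] ⟦ up u v ⟧
  size≡ = length-filter-product (λ (u , v) → (u <? v) ×-dec T? (adj G u v)) id id

  orient : ∀ u v → ⟦ up u v ⟧ + ⟦ up v u ⟧ ≡ ⟦ adj G u v ⟧
  orient u v with Fin.<-cmp u v
  ... | tri< u<v _ v≮u rewrite dec-true (u <? v) u<v | dec-false (v <? u) v≮u = ℕ.+-identityʳ _
  ... | tri≈ u≮v refl _ rewrite dec-false (u <? u) u≮v | adj-irrefl G u = refl
  ... | tri> u≮v _ v<u rewrite dec-false (u <? v) u≮v | dec-true (v <? u) v<u | adj-sym G u v = refl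

-- Isomorphisms and disjoint unions

≅-refl : (G : Graph n) → G ≅ G
≅-refl _ = ↔-id _ , λ _ _ → refl

≅-sym : (G : Graph m) (H : Graph n) → G ≅ H → H ≅ G
≅-sym _ H (φ , φ-adj) = ↔-sym φ , λ u v →
  sym (trans (φ-adj _ _) (cong₂ (adj H) (Inverse.strictlyInverseˡ φ u) (Inverse.strictlyInverseˡ φ v)))

≅-trans : (F : Graph a) (G : Graph m) (H : Graph n) → F ≅ G → G ≅ H → F ≅ H
≅-trans _ _ _ (φ , φ-adj) (ψ , ψ-adj) = ψ ↔-∘ φ , λ u v → trans (φ-adj u v) (ψ-adj _ _)

∪-congʳ : (F : Graph a) (G : Graph m) (H : Graph n) → G ≅ H → F ∪ G ≅ F ∪ H
∪-congʳ {a = a} {m} {n} F G H (φ , φ-adj) = ↔-sym +↔⊎ ↔-∘ ((↔-id _ ⊎-↔ φ) ↔-∘ +↔⊎) , eq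
  where
  φ⊎ : Fin a ⊎ Fin m → Fin a ⊎ Fin n
  φ⊎ = ⊎.map id (Inverse.to φ)

  eq⊎ : ∀ x y → sumAdj false F G x y ≡ sumAdj false F H (φ⊎ x) (φ⊎ y)
  eq⊎ (inj₁ _) (inj₁ _) = refl
  eq⊎ (inj₁ _) (inj₂ _) = refl
  eq⊎ (inj₂ _) (inj₁ _) = refl
  eq⊎ (inj₂ u) (inj₂ v) = φ-adj u v

  eq : ∀ u v → adj (F ∪ G) u v ≡ adj (F ∪ H) (join a n (φ⊎ (splitAt a u))) (join a n (φ⊎ (splitAt a v)))
  eq u v rewrite Fin.splitAt-join a n (φ⊎ (splitAt a u)) | Fin.splitAt-join a n (φ⊎ (splitAt a v)) =
    eq⊎ (splitAt a u) (splitAt a v)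

-- Needed because `suc q · K a ∪ K k` unfolds with the first clique nested on the left, while
-- inductions on `q` produce `K a ∪ (q · K a ∪ K k)`.
∪-assoc : (F : Graph a) (G : Graph b) (H : Graph c) → F ∪ (G ∪ H) ≅ (F ∪ G) ∪ H
∪-assoc {a} {b} {c} F G H =
  ↔-sym (+↔⊎ {a + b}) ↔-∘ ((↔-sym (+↔⊎ {a} {b}) ⊎-↔ ↔-id _) ↔-∘
    (↔-sym (⊎-assoc 0ℓ _ _ _) ↔-∘ ((↔-id _ ⊎-↔ +↔⊎ {b} {c}) ↔-∘ +↔⊎ {a}))) , eq
  where
  split₃ : Fin (a + (b + c)) → Fin a ⊎ (Fin b ⊎ Fin c)
  split₃ u = ⊎.map id (splitAt b) (splitAt a u)

  join₂ : Fin a ⊎ (Fin b ⊎ Fin c) → Fin (a + b) ⊎ Fin c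
  join₂ x = ⊎.map (join a b) id (⊎.assocˡ x)

  eq⊎ : ∀ x y → sumAdj false F (G ∪ H) x y ≡
        sumAdj false (F ∪ G) H (join₂ (⊎.map id (splitAt b) x)) (join₂ (⊎.map id (splitAt b) y))
  eq⊎ (inj₁ u) (inj₁ v) rewrite splitAt-↑ˡ a u b | splitAt-↑ˡ a v b = refl
  eq⊎ (inj₁ u) (inj₂ v) with splitAt b v
  ... | inj₁ v′ rewrite splitAt-↑ˡ a u b | splitAt-↑ʳ a b v′ = refl
  ... | inj₂ v′ = refl
  eq⊎ (inj₂ u) (inj₁ v) with splitAt b u
  ... | inj₁ u′ rewrite splitAt-↑ˡ a v b | splitAt-↑ʳ a b u′ = refl
  ... | inj₂ u′ = refl
  eq⊎ (inj₂ u) (inj₂ v) with splitAt b u | splitAt b v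
  ... | inj₁ u′ | inj₁ v′ rewrite splitAt-↑ʳ a b u′ | splitAt-↑ʳ a b v′ = refl
  ... | inj₁ u′ | inj₂ v′ = refl
  ... | inj₂ u′ | inj₁ v′ = refl
  ... | inj₂ u′ | inj₂ v′ = refl

  eq : ∀ u v → adj (F ∪ (G ∪ H)) u v ≡
       adj ((F ∪ G) ∪ H) (join (a + b) c (join₂ (split₃ u))) (join (a + b) c (join₂ (split₃ v)))
  eq u v rewrite Fin.splitAt-join (a + b) c (join₂ (split₃ u)) | Fin.splitAt-join (a + b) c (join₂ (split₃ v)) =
    eq⊎ (splitAt a u) (splitAt a v)

data SplitView (a b : ℕ) : Fin (a + b) → Set where
  left  : (i : Fin a) → SplitView a b (i ↑ˡ b)
  right : (j : Fin b) → SplitView a b (a ↑ʳ j)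

splitView : ∀ a b (x : Fin (a + b)) → SplitView a b x
splitView a b x = subst (SplitView a b) (Fin.join-splitAt a b x) (view (splitAt a x))
  where
  view : (y : Fin a ⊎ Fin b) → SplitView a b (join a b y)
  view (inj₁ i) = left i
  view (inj₂ j) = right j

module _ (G : Graph a) (H : Graph b) where
  adj-∪ˡˡ : ∀ i j → adj (G ∪ H) (i ↑ˡ b) (j ↑ˡ b) ≡ adj G i j
  adj-∪ˡˡ i j rewrite splitAt-↑ˡ a i b | splitAt-↑ˡ a j b = refl

  adj-∪ˡʳ : ∀ i j → adj (G ∪ H) (i ↑ˡ b) (a ↑ʳ j) ≡ false
  adj-∪ˡʳ i j rewrite splitAt-↑ˡ a i b | splitAt-↑ʳ a b j = refl

  adj-∪ʳˡ : ∀ i j → adj (G ∪ H) (a ↑ʳ i) (j ↑ˡ b) ≡ false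
  adj-∪ʳˡ i j rewrite splitAt-↑ʳ a b i | splitAt-↑ˡ a j b = refl

  adj-∪ʳʳ : ∀ i j → adj (G ∪ H) (a ↑ʳ i) (a ↑ʳ j) ≡ adj H i j
  adj-∪ʳʳ i j rewrite splitAt-↑ʳ a b i | splitAt-↑ʳ a b j = refl

  degreeSum-∪ : degreeSum (G ∪ H) ≡ degreeSum G + degreeSum H
  degreeSum-∪ = trans (∑-splitAt a _) (cong₂ _+_
    (sum-cong-≗ λ i → trans (∑-splitAt a _) (trans (cong₂ _+_
      (sum-cong-≗ λ j → cong ⟦_⟧ (adj-∪ˡˡ i j))
      (trans (sum-cong-≗ λ j → cong ⟦_⟧ (adj-∪ˡʳ i j)) (trans (∑-const b 0) (ℕ.*-zeroʳ b))))
      (ℕ.+-identityʳ _)))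
    (sum-cong-≗ λ i → trans (∑-splitAt a _) (cong₂ _+_
      (trans (sum-cong-≗ λ j → cong ⟦_⟧ (adj-∪ʳˡ i j)) (trans (∑-const a 0) (ℕ.*-zeroʳ a)))
      (sum-cong-≗ λ j → cong ⟦_⟧ (adj-∪ʳʳ i j)))))

degreeSum-≅ : (G : Graph m) (H : Graph n) → G ≅ H → degreeSum G ≡ degreeSum H
degreeSum-≅ _ H (φ , φ-adj) = trans
  (sum-cong-≗ λ u → trans (sum-cong-≗ λ v → cong ⟦_⟧ (φ-adj u v)) (sym (sum-permute _ φ)))
  (sym (sum-permute (degree H) φ))

degree-K : ∀ k u → degree (K (suc k)) u ≡ k
degree-K k       zero    = trans (∑-const k 1) (ℕ.*-identityʳ k)
degree-K (suc k) (suc u) = cong suc (trans (sum-cong-≗ (λ v → cong ⟦_⟧ (≟-suc v))) (degree-K k u))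
  where
  ≟-suc : ∀ v → adj (K (suc (suc k))) (suc u) (suc v) ≡ adj (K (suc k)) u v
  ≟-suc v with u ≟ v
  ... | yes _ = refl
  ... | no  _ = refl

degreeSum-K : ∀ k → degreeSum (K k) ≡ k * pred k
degreeSum-K zero    = refl
degreeSum-K (suc k) = trans (sum-cong-≗ (degree-K k)) (∑-const (suc k) k)

adj-K : {u v : Fin n} → u ≢ v → adj (K n) u v ≡ true
adj-K {u = u} {v} u≢v with u ≟ v
... | yes u≡v = contradiction u≡v u≢v
... | no  _   = refl

-- Disjoint unions of cliques are saturated

Adj-sym : (G : Graph n) {u v : Fin n} → Adj G u v → Adj G v u
Adj-sym G {u} {v} = subst T (adj-sym G u v)

-- Distinct indices have adjacent, hence distinct, images, so injectivity is derived instead of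
-- stored.
Clique : Graph n → (Fin a → Fin n) → Set
Clique G g = ∀ {i j} → i ≢ j → Adj G (g i) (g j)

Clique-injective : (G : Graph n) {g : Fin a → Fin n} → Clique G g → Injective _≡_ _≡_ g
Clique-injective G clique {i} {j} gi≡gj with i ≟ j
... | yes i≡j = i≡j
... | no  i≢j = contradiction gi≡gj (Adj⇒≢ G (clique i≢j))

InClique : ℕ → Graph n → Fin n → Set
InClique {n} a G u = Σ[ g ∈ (Fin a → Fin n) ] Clique G g × ∃[ i ] g i ≡ u

-- A copy of F without its numbering of vertices: `hub` may be any index, so a clique need not be
-- reordered to attach a leaf. The clique number p is `suc a`.
record PendantClique (a : ℕ) (G : Graph n) : Set where
  constructor pendantClique
  field
    g      : Fin (suc a) → Fin n
    clique : Clique G g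
    hub    : Fin (suc a)
    leaf   : Fin n
    leaf∉  : ∀ i → leaf ≢ g i
    edge   : Adj G (g hub) leaf

Contains⇒PendantClique : (G : Graph n) → Contains G (K 1 ∨ (K a ∪ K 1)) → PendantClique a G
Contains⇒PendantClique {a = a} G (f , f-inj , f-adj) = record
  { g = g ; clique = clique ; hub = zero ; leaf = f (suc (a ↑ʳ zero))
  ; leaf∉ = leaf∉ ; edge = f-adj zero (suc (a ↑ʳ zero)) tt }
  where
  g : Fin (suc a) → Fin _
  g zero    = f zero
  g (suc i) = f (suc (i ↑ˡ 1))

  clique : Clique G g
  clique {zero}  {zero}  i≢j = contradiction refl i≢j
  clique {zero}  {suc j} i≢j = f-adj _ _ tt
  clique {suc i} {zero}  i≢j = f-adj _ _ tt
  clique {suc i} {suc j} i≢j = f-adj _ _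
    (subst T (sym (trans (adj-∪ˡˡ (K a) (K 1) i j) (adj-K (i≢j ∘ cong suc)))) tt)

  leaf∉ : ∀ i → f (suc (a ↑ʳ zero)) ≢ g i
  leaf∉ zero    eq with () ← f-inj eq
  leaf∉ (suc i) eq with () ← trans (sym (splitAt-↑ʳ a 1 zero))
    (trans (cong (splitAt a) (Fin.suc-injective (f-inj eq))) (splitAt-↑ˡ a i 1))

PendantClique⇒Contains : (G : Graph n) → PendantClique a G → Contains G (K 1 ∨ (K a ∪ K 1))
PendantClique⇒Contains {n} {a} G (pendantClique g clique hub leaf leaf∉ edge) = f , f-inj , f-adj
  where
  f⊎ : Fin a ⊎ Fin 1 → Fin n
  f⊎ (inj₁ i) = g (punchIn hub i)
  f⊎ (inj₂ _) = leaf

  f : Fin (1 + (a + 1)) → Fin n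
  f zero    = g hub
  f (suc x) = f⊎ (splitAt a x)

  hub≢ : ∀ i → hub ≢ punchIn hub i
  hub≢ i = Fin.punchInᵢ≢i hub i ∘ sym

  g-inj : Injective _≡_ _≡_ g
  g-inj = Clique-injective G clique

  f⊎-inj : Injective _≡_ _≡_ f⊎
  f⊎-inj {inj₁ i} {inj₁ j} eq = cong inj₁ (Fin.punchIn-injective hub i j (g-inj eq))
  f⊎-inj {inj₁ i} {inj₂ j} eq = contradiction (sym eq) (leaf∉ _)
  f⊎-inj {inj₂ i} {inj₁ j} eq = contradiction eq (leaf∉ _)
  f⊎-inj {inj₂ zero} {inj₂ zero} eq = refl

  f⊎≢hub : ∀ x → g hub ≢ f⊎ x
  f⊎≢hub (inj₁ i) eq = hub≢ i (g-inj eq)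
  f⊎≢hub (inj₂ _) eq = leaf∉ hub (sym eq)

  f-inj : Injective _≡_ _≡_ f
  f-inj {zero}  {zero}  _  = refl
  f-inj {zero}  {suc y} eq = contradiction eq (f⊎≢hub (splitAt a y))
  f-inj {suc x} {zero}  eq = contradiction (sym eq) (f⊎≢hub (splitAt a x))
  f-inj {suc x} {suc y} eq = cong suc (trans (sym (Fin.join-splitAt a 1 x))
    (trans (cong (join a 1) (f⊎-inj {splitAt a x} {splitAt a y} eq)) (Fin.join-splitAt a 1 y)))

  hub-adj : ∀ x → Adj G (g hub) (f⊎ x)
  hub-adj (inj₁ i) = clique (hub≢ i)
  hub-adj (inj₂ _) = edge

  f⊎-adj : ∀ x y → T (sumAdj false (K a) (K 1) x y) → Adj G (f⊎ x) (f⊎ y)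
  f⊎-adj (inj₁ i) (inj₁ j) adj-ij = clique (Adj⇒≢ (K a) adj-ij ∘ Fin.punchIn-injective hub i j)
  f⊎-adj (inj₂ zero) (inj₂ zero) ()

  f-adj : ∀ x y → Adj (K 1 ∨ (K a ∪ K 1)) x y → Adj G (f x) (f y)
  f-adj zero    (suc y) _   = hub-adj (splitAt a y)
  f-adj (suc x) zero    _   = Adj-sym G (hub-adj (splitAt a x))
  f-adj (suc x) (suc y) axy = f⊎-adj (splitAt a x) (splitAt a y) axy

module _ (G : Graph n) {u v : Fin n} (u≢v : u ≢ v) where
  Adj⇒Adj-addEdge : ∀ {x y} → Adj G x y → Adj (addEdge G u v u≢v) x y
  Adj⇒Adj-addEdge {x} {y} = Equivalence.from (T-∨ {adj G x y}) ∘ inj₁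

  addEdge-uv : Adj (addEdge G u v u≢v) u v
  addEdge-uv rewrite ≟-refl u | ≟-refl v = Equivalence.from (T-∨ {adj G u v}) (inj₂ tt)

  Adj-addEdge⇒ : ∀ {x y} → Adj (addEdge G u v u≢v) x y → Adj G x y ⊎ (x ≡ u × y ≡ v) ⊎ (x ≡ v × y ≡ u)
  Adj-addEdge⇒ {x} {y} e with Equivalence.to (T-∨ {adj G x y}) e
  ... | inj₁ axy = inj₁ axy
  ... | inj₂ e′ with x ≟ u | y ≟ v | x ≟ v | y ≟ u
  ...   | yes p | yes q | _     | _     = inj₂ (inj₁ (p , q))
  ...   | _     | _     | yes p | yes q = inj₂ (inj₂ (p , q))
  ...   | yes _ | no _  | yes _ | no _  = contradiction e′ id
  ...   | yes _ | no _  | no _  | _     = contradiction e′ id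
  ...   | no _  | _     | no _  | _     = contradiction e′ id
  ...   | no _  | _     | yes _ | no _  = contradiction e′ id

-- Describes disjoint cliques without naming the blocks: transitivity makes components complete,
-- `no-clique` bounds their order by `suc a`, and `covered` allows at most one component below that
-- order.
record Packed (a : ℕ) (G : Graph n) : Set where
  field
    Adj-trans : ∀ {x y z} → Adj G x y → Adj G y z → x ≢ z → Adj G x z
    no-clique : ¬ (Σ[ g ∈ (Fin (suc (suc a)) → Fin n) ] Clique G g)
    covered   : ∀ {u v} → u ≢ v → ¬ Adj G u v → InClique (suc a) G u ⊎ InClique (suc a) G v

Packed-≅ : {G : Graph m} {H : Graph n} → G ≅ H → Packed a H → Packed a G
Packed-≅ {m} {n} {G = G} {H} (φ , φ-adj) packed = record
  { Adj-trans = λ axy ayz x≢z → to⁻ (Adj-trans (to⁺ axy) (to⁺ ayz) (x≢z ∘ to-inj))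
  ; no-clique = λ (g , clique) → no-clique (to ∘ g , λ i≢j → to⁺ (clique i≢j))
  ; covered   = λ u≢v ¬auv → ⊎.map pull pull (covered (u≢v ∘ to-inj) (¬auv ∘ to⁻)) }
  where
  open Packed packed
  open Inverse φ using (to; from; strictlyInverseˡ; strictlyInverseʳ)

  to-inj : ∀ {x y} → to x ≡ to y → x ≡ y
  to-inj {x} {y} eq = trans (sym (strictlyInverseʳ x)) (trans (cong from eq) (strictlyInverseʳ y))

  to⁺ : ∀ {x y} → Adj G x y → Adj H (to x) (to y)
  to⁺ = subst T (φ-adj _ _)

  to⁻ : ∀ {x y} → Adj H (to x) (to y) → Adj G x y
  to⁻ = subst T (sym (φ-adj _ _))

  pull : ∀ {u} → InClique b H (to u) → InClique b G u
  pull {u = u} (g , clique , i , eq) = from ∘ g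
    , (λ i≢j → to⁻ (subst₂ (Adj H) (sym (strictlyInverseˡ _)) (sym (strictlyInverseˡ _)) (clique i≢j)))
    , i , trans (cong from eq) (strictlyInverseʳ u)

Packed-K : k ≤ suc a → Packed a (K k)
Packed-K k≤ = record
  { Adj-trans = λ _ _ x≢z → subst T (sym (adj-K x≢z)) tt
  ; no-clique = λ (g , clique) → ℕ.<⇒≱ (s≤s k≤) (Fin.injective⇒≤ (Clique-injective (K _) {g} clique))
  ; covered   = λ u≢v ¬auv → contradiction (subst T (sym (adj-K u≢v)) tt) ¬auv }

Packed-∪ : {H : Graph b} → Packed a H → Packed a (K (suc a) ∪ H)
Packed-∪ {b} {a} {H} packed = record { Adj-trans = λ {x} {y} → trns {x} {y} ; no-clique = none ; covered = cov }
  where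
  open Packed packed
  G : Graph (suc a + b)
  G = K (suc a) ∪ H

  LL : ∀ i j → i ≢ j → Adj G (i ↑ˡ b) (j ↑ˡ b)
  LL i j i≢j = subst T (sym (trans (adj-∪ˡˡ (K _) H _ _) (adj-K i≢j))) tt

  LR : ∀ i j → ¬ Adj G (i ↑ˡ b) (suc a ↑ʳ j)
  LR i j e = subst T (adj-∪ˡʳ (K (suc a)) H i j) e

  RL : ∀ i j → ¬ Adj G (suc a ↑ʳ i) (j ↑ˡ b)
  RL i j e = subst T (adj-∪ʳˡ (K (suc a)) H i j) e

  RR⁻ : ∀ i j → Adj G (suc a ↑ʳ i) (suc a ↑ʳ j) → Adj H i j
  RR⁻ i j = subst T (adj-∪ʳʳ (K (suc a)) H i j)

  RR⁺ : ∀ i j → Adj H i j → Adj G (suc a ↑ʳ i) (suc a ↑ʳ j)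
  RR⁺ i j = subst T (sym (adj-∪ʳʳ (K (suc a)) H i j))

  view : ∀ x → SplitView (suc a) b x
  view = splitView (suc a) b

  trns : ∀ {x y z} → Adj G x y → Adj G y z → x ≢ z → Adj G x z
  trns {x} {y} {z} axy ayz x≢z with view x | view y | view z
  ... | left i  | _       | left k  = LL i k (x≢z ∘ cong (_↑ˡ b))
  ... | left i  | left j  | right k = contradiction ayz (LR j k)
  ... | left i  | right j | right k = contradiction axy (LR i j)
  ... | right i | left j  | _       = contradiction axy (RL i j)
  ... | right i | right j | left k  = contradiction ayz (RL j k)
  ... | right i | right j | right k = RR⁺ i k (Adj-trans (RR⁻ i j axy) (RR⁻ j k ayz) (x≢z ∘ cong (suc a ↑ʳ_)))

  -- A clique cannot straddle the union, so `g zero` decides its side: on the left the pigeonhole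
  -- principle refutes it, on the right it would be a clique of `H`.
  none : ¬ (Σ[ g ∈ (Fin (suc (suc a)) → Fin (suc a + b)) ] Clique G g)
  none (g , clique) with g zero in eq | view (g zero)
  ... | _ | left i₀ = ℕ.<⇒≱ (ℕ.n<1+n _) (Fin.injective⇒≤ {f = proj₁ ∘ lefts} λ {i} {j} e →
      Clique-injective G clique (trans (proj₂ (lefts i)) (trans (cong (_↑ˡ b) e) (sym (proj₂ (lefts j))))))
    where
    lefts : ∀ j → ∃[ i ] g j ≡ i ↑ˡ b
    lefts zero    = i₀ , eq
    lefts (suc j) with clique {zero} {suc j} (λ ())
    ... | e rewrite eq with g (suc j) | view (g (suc j))
    ...   | _ | left i  = i , refl
    ...   | _ | right i = contradiction e (LR i₀ i)
  ... | _ | right i₀ = no-clique (proj₁ ∘ rights , λ {i} {j} i≢j →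
      RR⁻ _ _ (subst₂ (Adj G) (proj₂ (rights i)) (proj₂ (rights j)) (clique i≢j)))
    where
    rights : ∀ j → ∃[ i ] g j ≡ suc a ↑ʳ i
    rights zero    = i₀ , eq
    rights (suc j) with clique {zero} {suc j} (λ ())
    ... | e rewrite eq with g (suc j) | view (g (suc j))
    ...   | _ | left i  = contradiction e (RL i₀ i)
    ...   | _ | right i = i , refl

  inLeft : ∀ i → InClique (suc a) G (i ↑ˡ b)
  inLeft i = (_↑ˡ b) , LL _ _ , i , refl

  inRight : ∀ {j} → InClique (suc a) H j → InClique (suc a) G (suc a ↑ʳ j)
  inRight (g , clique , i , eq) = (suc a ↑ʳ_) ∘ g , (λ i≢j → RR⁺ _ _ (clique i≢j)) , i , cong (suc a ↑ʳ_) eq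

  cov : ∀ {u v} → u ≢ v → ¬ Adj G u v → InClique (suc a) G u ⊎ InClique (suc a) G v
  cov {u} {v} u≢v ¬auv with view u | view v
  ... | left i  | _       = inj₁ (inLeft i)
  ... | right i | left j  = inj₂ (inLeft j)
  ... | right i | right j =
    ⊎.map inRight inRight (covered (u≢v ∘ cong (suc a ↑ʳ_)) (¬auv ∘ RR⁺ i j))

Packed-canonical : ∀ q → k ≤ suc a → Packed a (q · K (suc a) ∪ K k)
Packed-canonical         zero    k≤ = Packed-K k≤
Packed-canonical {k} {a} (suc q) k≤ =
  Packed-≅ (≅-sym (K (suc a) ∪ (q · K (suc a) ∪ K k)) (suc q · K (suc a) ∪ K k)
             (∪-assoc (K (suc a)) (q · K (suc a)) (K k))) (Packed-∪ (Packed-canonical q k≤))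

-- By transitivity a leaf at a K_p would be adjacent to all of it, giving a K_{p+1}. Conversely, one
-- end of a missing edge lies in a K_p, and the other end becomes its leaf once the edge is added.
Packed⇒Saturated : (G : Graph n) → Packed a G → Saturated (K 1 ∨ (K a ∪ K 1)) G
Packed⇒Saturated {n} {a} G packed = (λ F⊆G → free (Contains⇒PendantClique G F⊆G)) , λ u v e →
  let u≢v = Adj⇒≢ (complement G) e
      G+uv = addEdge G u v u≢v
      ¬auv = complement-¬Adj u v e
  in [ (λ cu → PendantClique⇒Contains G+uv (grow u≢v ¬auv cu (Adj⇒Adj-addEdge G u≢v) (addEdge-uv G u≢v)))
     , (λ cv → PendantClique⇒Contains G+uv (grow (u≢v ∘ sym) (¬auv ∘ Adj-sym G) cv (Adj⇒Adj-addEdge G u≢v)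
                 (Adj-sym (addEdge G u v u≢v) (addEdge-uv G u≢v))))
     ]′ (covered u≢v ¬auv)
  where
  open Packed packed

  complement-¬Adj : ∀ u v → Adj (complement G) u v → ¬ Adj G u v
  complement-¬Adj u v e auv with adj G u v
  ... | true  = e
  ... | false = auv

  free : ¬ PendantClique a G
  free (pendantClique g clique hub leaf leaf∉ edge) = no-clique (g⁺ , clique⁺)
    where
    g⁺ : Fin (suc (suc a)) → Fin n
    g⁺ zero    = leaf
    g⁺ (suc i) = g i

    leaf-adj : ∀ i → Adj G leaf (g i)
    leaf-adj i with hub ≟ i
    ... | yes refl  = Adj-sym G edge
    ... | no  hub≢i = Adj-trans (Adj-sym G edge) (clique hub≢i) (leaf∉ i)

    clique⁺ : Clique G g⁺
    clique⁺ {zero}  {zero}  i≢j = contradiction refl i≢j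
    clique⁺ {zero}  {suc j} _   = leaf-adj j
    clique⁺ {suc i} {zero}  _   = Adj-sym G (leaf-adj i)
    clique⁺ {suc i} {suc j} i≢j = clique {i} {j} (i≢j ∘ cong suc)

  grow : ∀ {u v} → u ≢ v → ¬ Adj G u v → InClique (suc a) G u → {H : Graph n} →
         (∀ {x y} → Adj G x y → Adj H x y) → Adj H u v → PendantClique a H
  grow {v = v} u≢v ¬auv (g , clique , i , refl) G⊆H e =
    pendantClique g (λ i≢j → G⊆H (clique i≢j)) i v v∉ e
    where
    v∉ : ∀ j → v ≢ g j
    v∉ j refl with i ≟ j
    ... | yes refl = u≢v refl
    ... | no  i≢j  = ¬auv (clique i≢j)

-- Peeling off cliques

-- What a copy of F in G + uv leaves behind in G when its K_p contains both u and v. Here m = p - 2,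
-- `core` is the rest of the K_p, `foot` its hub. Every recorded edge is an edge of G itself.
record Bridge (m : ℕ) (G : Graph n) (u v : Fin n) : Set where
  field
    core   : Fin m → Fin n
    clique : Clique G core
    u-core : ∀ i → Adj G u (core i)
    v-core : ∀ i → Adj G v (core i)
    foot   : Fin n
    leaf   : Fin n
    foot∈  : foot ≡ u ⊎ foot ≡ v ⊎ ∃[ i ] foot ≡ core i
    edge   : Adj G foot leaf
    leaf≢u : leaf ≢ u
    leaf≢v : leaf ≢ v
    leaf∉  : ∀ i → leaf ≢ core i

-- Unlike saturation, this property passes to what remains after deleting a
-- clique on 2 + m vertices; the edge from foot to leaf keeps the leaf of a
-- bridge in that remainder.
record Reduced (m : ℕ) (G : Graph n) : Set where
  field
    closed : ∀ {g : Fin (2 + m) → Fin n} → Clique G g → ∀ i {y} → Adj G (g i) y → ∃[ j ] y ≡ g j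
    bridge : ∀ {u v} → u ≢ v → ¬ Adj G u v →
             InClique (2 + m) G u ⊎ InClique (2 + m) G v ⊎ Bridge m G u v

-- A K_p with a neighbour outside is already a copy of F, whence `closed`. For `bridge`, consider
-- the copy of F in G + uv. If its K_p misses u or v, that K_p lies in G, so uv must be the pendant
-- edge and the hub is u or v. Otherwise deleting uv leaves a bridge.
Saturated⇒Reduced : (G : Graph n) → Saturated (K 1 ∨ (K (suc m) ∪ K 1)) G → Reduced m G
Saturated⇒Reduced {n} {m} G (F⊈G , sat) = record { closed = λ {g} → closed g ; bridge = bridge }
  where
  closed : (g : Fin (2 + m) → Fin n) → Clique G g → ∀ i {y} → Adj G (g i) y → ∃[ j ] y ≡ g j
  closed g clique i {y} e with any? (λ j → y ≟ g j)
  ... | yes y∈ = y∈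
  ... | no  y∉ = contradiction
    (PendantClique⇒Contains G (pendantClique g clique i y (λ j eq → y∉ (j , eq)) e)) F⊈G

  complement-Adj : ∀ {u v} → u ≢ v → ¬ Adj G u v → Adj (complement G) u v
  complement-Adj {u} {v} u≢v ¬auv with adj G u v | u ≟ v
  ... | _     | yes u≡v = contradiction u≡v u≢v
  ... | true  | no  _   = contradiction tt ¬auv
  ... | false | no  _   = tt

  module _ {u v : Fin n} (u≢v : u ≢ v) (P : PendantClique (suc m) (addEdge G u v u≢v)) where
    open PendantClique P

    inCliques : (∀ i j → ¬ (g i ≡ u × g j ≡ v)) → InClique (2 + m) G u ⊎ InClique (2 + m) G v
    inCliques missing = place (Adj-addEdge⇒ G u≢v edge)
      where
      cliqueG : Clique G g
      cliqueG {i} {j} i≢j with Adj-addEdge⇒ G u≢v (clique i≢j)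
      ... | inj₁ e                = e
      ... | inj₂ (inj₁ (eᵢ , eⱼ)) = contradiction (eᵢ , eⱼ) (missing i j)
      ... | inj₂ (inj₂ (eᵢ , eⱼ)) = contradiction (eⱼ , eᵢ) (missing j i)

      place : Adj G (g hub) leaf ⊎ (g hub ≡ u × leaf ≡ v) ⊎ (g hub ≡ v × leaf ≡ u) →
              InClique (2 + m) G u ⊎ InClique (2 + m) G v
      place (inj₁ e)              = contradiction
        (PendantClique⇒Contains G (pendantClique g cliqueG hub leaf leaf∉ e)) F⊈G
      place (inj₂ (inj₁ (eq , _))) = inj₁ (g , cliqueG , hub , eq)
      place (inj₂ (inj₂ (eq , _))) = inj₂ (g , cliqueG , hub , eq)

    toBridge : ∀ i j → g i ≡ u → g j ≡ v → Bridge m G u v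
    toBridge i j gi≡u gj≡v = record
      { core = g ∘ σ ; clique = λ l≢l′ → inG (gσ≢u _) (gσ≢v _) (clique (l≢l′ ∘ σ-inj))
      ; u-core = λ l → Adj-sym G (inG (gσ≢u l) (gσ≢v l) (subst (Adj G+uv (g (σ l))) gi≡u (clique (σ≢i l))))
      ; v-core = λ l → Adj-sym G (inG (gσ≢u l) (gσ≢v l) (subst (Adj G+uv (g (σ l))) gj≡v (clique (σ≢j l))))
      ; foot = g hub ; leaf = leaf ; foot∈ = foot∈
      -- The edge is read from the leaf, the end known to differ from u and v; the hub may be one of
      -- them.
      ; edge = Adj-sym G (inG leaf≢u leaf≢v (Adj-sym G+uv edge))
      ; leaf≢u = leaf≢u ; leaf≢v = leaf≢v ; leaf∉ = leaf∉ ∘ σ }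
      where
      G+uv : Graph n
      G+uv = addEdge G u v u≢v

      inG : ∀ {x y} → x ≢ u → x ≢ v → Adj G+uv x y → Adj G x y
      inG x≢u x≢v e with Adj-addEdge⇒ G u≢v e
      ... | inj₁ axy             = axy
      ... | inj₂ (inj₁ (eq , _)) = contradiction eq x≢u
      ... | inj₂ (inj₂ (eq , _)) = contradiction eq x≢v

      g-inj : Injective _≡_ _≡_ g
      g-inj = Clique-injective G+uv clique

      leaf≢u : leaf ≢ u
      leaf≢u eq = leaf∉ i (trans eq (sym gi≡u))

      leaf≢v : leaf ≢ v
      leaf≢v eq = leaf∉ j (trans eq (sym gj≡v))

      i≢j : i ≢ j
      i≢j eq = u≢v (trans (sym gi≡u) (trans (cong g eq) gj≡v))

      -- `punchOut i≢j` is the position of `j` after `i` is removed, so `σ` lists the indices other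
      -- than `i` and `j`.
      σ : Fin m → Fin (2 + m)
      σ l = punchIn i (punchIn (punchOut i≢j) l)

      σ-inj : ∀ {l l′} → σ l ≡ σ l′ → l ≡ l′
      σ-inj eq = Fin.punchIn-injective (punchOut i≢j) _ _ (Fin.punchIn-injective i _ _ eq)

      σ≢i : ∀ l → σ l ≢ i
      σ≢i l = Fin.punchInᵢ≢i i _

      σ≢j : ∀ l → σ l ≢ j
      σ≢j l eq = Fin.punchInᵢ≢i (punchOut i≢j) l
        (Fin.punchIn-injective i _ _ (trans eq (sym (Fin.punchIn-punchOut i≢j))))

      gσ≢u : ∀ l → g (σ l) ≢ u
      gσ≢u l eq = σ≢i l (g-inj (trans eq (sym gi≡u)))

      gσ≢v : ∀ l → g (σ l) ≢ v
      gσ≢v l eq = σ≢j l (g-inj (trans eq (sym gj≡v)))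

      foot∈ : g hub ≡ u ⊎ g hub ≡ v ⊎ ∃[ l ] g hub ≡ g (σ l)
      foot∈ with i ≟ hub
      ... | yes refl = inj₁ gi≡u
      ... | no i≢h with punchOut i≢j ≟ punchOut i≢h
      ...   | yes eq = inj₂ (inj₁ (trans (cong g (sym (Fin.punchOut-injective i≢j i≢h eq))) gj≡v))
      ...   | no  ne = inj₂ (inj₂ (punchOut ne , cong g (sym
                (trans (cong (punchIn i) (Fin.punchIn-punchOut ne)) (Fin.punchIn-punchOut i≢h)))))

  bridge : ∀ {u v} → u ≢ v → ¬ Adj G u v →
           InClique (2 + m) G u ⊎ InClique (2 + m) G v ⊎ Bridge m G u v
  bridge {u} {v} u≢v ¬auv
    with e ← complement-Adj u≢v ¬auv
    with P ← Contains⇒PendantClique (addEdge G u v (Adj⇒≢ (complement G) e)) (sat u v e)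
    with any? (λ i → PendantClique.g P i ≟ u) | any? (λ j → PendantClique.g P j ≟ v)
  ... | yes (i , gi≡u) | yes (j , gj≡v) = inj₂ (inj₂ (toBridge _ P i j gi≡u gj≡v))
  ... | no  u∉         | _              = ⊎.map₂ inj₁ (inCliques _ P λ i j eqs → u∉ (i , proj₁ eqs))
  ... | yes _          | no v∉          = ⊎.map₂ inj₁ (inCliques _ P λ i j eqs → v∉ (j , proj₂ eqs))

-- By `closed` no edge leaves the clique, so G splits and every neighbour of a surviving vertex
-- survives (`lift`). A bridge is therefore kept whole: its core hangs on u, its foot is u, v or in
-- the core, and its leaf hangs on the foot. A K_p through a survivor is kept for the same reason.
peel : (G : Graph n) → Reduced m G → (g : Fin (2 + m) → Fin n) → Clique G g →
       ∃[ b ] (2 + m + b ≡ n) × Σ[ G′ ∈ Graph b ] (G ≅ K (2 + m) ∪ G′) × Reduced m G′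
peel {n} {m} G red g clique with b , π , π-g ← extendInjection g (Clique-injective G clique)
  = b , Perm.↔⇒≡ π , G′ , ≅-sym (K p ∪ G′) G (π , eq) , record { closed = closed′ ; bridge = bridge′ }
  where
  open Reduced red

  p : ℕ
  p = 2 + m

  ι : Fin b → Fin n
  ι j = π ⟨$⟩ʳ (p ↑ʳ j)

  π-inj : ∀ {x y} → π ⟨$⟩ʳ x ≡ π ⟨$⟩ʳ y → x ≡ y
  π-inj {x} {y} eq = trans (sym (Perm.inverseˡ π)) (trans (cong (π ⟨$⟩ˡ_) eq) (Perm.inverseˡ π))

  ι-inj : ∀ {i j} → ι i ≡ ι j → i ≡ j
  ι-inj eq = Fin.↑ʳ-injective p _ _ (π-inj eq)

  ι≢g : ∀ {i j} → ι j ≢ g i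
  ι≢g {i} {j} eq with () ← trans (sym (splitAt-↑ˡ p i b))
    (trans (cong (splitAt p) (π-inj (trans (π-g i) (sym eq)))) (splitAt-↑ʳ p b j))

  G′ : Graph b
  G′ .adj i j      = adj G (ι i) (ι j)
  G′ .adj-sym i j  = adj-sym G (ι i) (ι j)
  G′ .adj-irrefl i = adj-irrefl G (ι i)

  cross : ∀ i j → adj G (g i) (ι j) ≡ false
  cross i j with adj G (g i) (ι j) in eq
  ... | false = refl
  ... | true  = contradiction (proj₂ (closed clique i (subst T (sym eq) tt))) ι≢g

  eq : ∀ x y → adj (K p ∪ G′) x y ≡ adj G (π ⟨$⟩ʳ x) (π ⟨$⟩ʳ y)
  eq x y with splitView p b x | splitView p b y
  ... | left i  | right j rewrite π-g i = trans (adj-∪ˡʳ (K p) G′ i j) (sym (cross i j))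
  ... | right i | left j  rewrite π-g j = trans (adj-∪ʳˡ (K p) G′ i j)
                                            (sym (trans (adj-sym G (ι i) (g j)) (cross j i)))
  ... | right i | right j = adj-∪ʳʳ (K p) G′ i j
  ... | left i  | left j rewrite π-g i | π-g j with i ≟ j
  ...   | yes refl = trans (adj-irrefl (K p ∪ G′) (i ↑ˡ b)) (sym (adj-irrefl G (g i)))
  ...   | no  i≢j  = trans (adj-∪ˡˡ (K p) G′ i j) (trans (adj-K i≢j) (sym (Equivalence.to T-≡ (clique i≢j))))

  lift : ∀ {i x} → Adj G (ι i) x → ∃[ j ] x ≡ ι j
  lift {i} {x} e with π ⟨$⟩ˡ x in eqx | splitView p b (π ⟨$⟩ˡ x)
  ... | _ | right j = j , trans (sym (Perm.inverseʳ π)) (cong (π ⟨$⟩ʳ_) eqx)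
  ... | _ | left  j = ⊥-elim (subst T (cross j i) (Adj-sym G (subst (Adj G (ι i)) x≡g e)))
    where
    x≡g : x ≡ g j
    x≡g = trans (sym (Perm.inverseʳ π)) (trans (cong (π ⟨$⟩ʳ_) eqx) (π-g j))

  closed′ : ∀ {h : Fin p → Fin b} → Clique G′ h → ∀ i {y} → Adj G′ (h i) y → ∃[ j ] y ≡ h j
  closed′ h-clique i e with j , eq ← closed h-clique i e = j , ι-inj eq

  liftClique : ∀ {u} → InClique p G (ι u) → InClique p G′ u
  liftClique {u} (h , h-clique , i , hi≡ιu) = proj₁ ∘ h′
    , (λ {j} {k} j≢k → subst₂ (Adj G) (proj₂ (h′ j)) (proj₂ (h′ k)) (h-clique j≢k))
    , i , ι-inj (trans (sym (proj₂ (h′ i))) hi≡ιu)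
    where
    h′ : ∀ j → ∃[ k ] h j ≡ ι k
    h′ j with i ≟ j
    ... | yes refl = u , hi≡ιu
    ... | no  i≢j  = lift (subst (λ x → Adj G x (h j)) hi≡ιu (h-clique i≢j))

  liftBridge : ∀ {u v} → Bridge m G (ι u) (ι v) → Bridge m G′ u v
  liftBridge {u} {v} B = record
    { core = proj₁ ∘ c′
    ; clique = λ i≢j → subst₂ (Adj G) (proj₂ (c′ _)) (proj₂ (c′ _)) (B.clique i≢j)
    ; u-core = λ i → subst (Adj G (ι u)) (proj₂ (c′ i)) (B.u-core i)
    ; v-core = λ i → subst (Adj G (ι v)) (proj₂ (c′ i)) (B.v-core i)
    ; foot = proj₁ foot′ ; leaf = proj₁ leaf′ ; foot∈ = proj₂ (proj₂ foot′)
    ; edge = edge′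
    ; leaf≢u = λ eq → B.leaf≢u (trans (proj₂ leaf′) (cong ι eq))
    ; leaf≢v = λ eq → B.leaf≢v (trans (proj₂ leaf′) (cong ι eq))
    ; leaf∉ = λ i eq → B.leaf∉ i (trans (proj₂ leaf′) (trans (cong ι eq) (sym (proj₂ (c′ i))))) }
    where
    module B = Bridge B

    c′ : ∀ i → ∃[ j ] B.core i ≡ ι j
    c′ i = lift (B.u-core i)

    foot′ : ∃[ j ] (B.foot ≡ ι j × (j ≡ u ⊎ j ≡ v ⊎ ∃[ i ] j ≡ proj₁ (c′ i)))
    foot′ with B.foot∈
    ... | inj₁ eq              = u , eq , inj₁ refl
    ... | inj₂ (inj₁ eq)       = v , eq , inj₂ (inj₁ refl)
    ... | inj₂ (inj₂ (i , eq)) = proj₁ (c′ i) , trans eq (proj₂ (c′ i)) , inj₂ (inj₂ (i , refl))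

    leaf′ : ∃[ j ] B.leaf ≡ ι j
    leaf′ = lift (subst (λ x → Adj G x B.leaf) (proj₁ (proj₂ foot′)) B.edge)

    edge′ : Adj G (ι (proj₁ foot′)) (ι (proj₁ leaf′))
    edge′ = subst₂ (Adj G) (proj₁ (proj₂ foot′)) (proj₂ leaf′) B.edge

  bridge′ : ∀ {u v} → u ≢ v → ¬ Adj G′ u v →
            InClique p G′ u ⊎ InClique p G′ v ⊎ Bridge m G′ u v
  bridge′ u≢v ¬auv = ⊎.map liftClique (⊎.map liftClique liftBridge) (bridge (u≢v ∘ ι-inj) ¬auv)

-- Remainders without large cliques

-- Replaces a decision procedure for the existence of cliques or bridges: each index either delivers
-- the global witness `A` or its own local fact.
search : {A : Set} {B : Fin n → Set} → (∀ i → A ⊎ B i) → A ⊎ (∀ i → B i)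
search {zero}  f = inj₂ λ ()
search {suc n} f with f zero | search (f ∘ suc)
... | inj₁ a  | _       = inj₁ a
... | inj₂ _  | inj₁ a  = inj₁ a
... | inj₂ b₀ | inj₂ bs = inj₂ λ { zero → b₀ ; (suc i) → bs i }

∷-injective : {x : Fin n} {f : Fin a → Fin n} → (∀ i → x ≢ f i) → Injective _≡_ _≡_ f →
              Injective _≡_ _≡_ (x ∷ f)
∷-injective x∉ f-inj {zero}  {zero}  _  = refl
∷-injective x∉ f-inj {zero}  {suc j} eq = contradiction eq (x∉ j)
∷-injective x∉ f-inj {suc i} {zero}  eq = contradiction (sym eq) (x∉ i)
∷-injective x∉ f-inj {suc i} {suc j} eq = cong suc (f-inj eq)

∷-all : {P : Fin n → Set} {x : Fin n} {f : Fin a → Fin n} → P x → (∀ i → P (f i)) → ∀ i → P ((x ∷ f) i)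
∷-all px pf zero    = px
∷-all px pf (suc i) = pf i

module _ (G : Graph n) where
  injection⇒≤degree : ∀ {v} (g : Fin a → Fin n) → Injective _≡_ _≡_ g → (∀ i → Adj G v (g i)) → a ≤ degree G v
  injection⇒≤degree {v = v} g g-inj = injection⇒≤∑ g g-inj (adj G v)

  -- A neighbour outside the image of `g` would give a + 1 distinct neighbours.
  degree-exhausted : ∀ {v} (g : Fin a → Fin n) → Injective _≡_ _≡_ g → (∀ i → Adj G v (g i)) →
                     degree G v ≤ a → ∀ {x} → Adj G v x → ∃[ i ] x ≡ g i
  degree-exhausted g g-inj g-adj deg≤ {x} avx with any? (λ i → x ≟ g i)
  ... | yes x∈ = x∈
  ... | no  x∉ = contradiction deg≤ (ℕ.<⇒≱ (injection⇒≤degree (x ∷ g)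
                   (∷-injective (λ i eq → x∉ (i , eq)) g-inj) (∷-all {P = Adj G _} avx g-adj)))

dominating⇒≤degree : (G : Graph (suc n)) {x : Fin (suc n)} → (∀ {y} → x ≢ y → Adj G x y) → n ≤ degree G x
dominating⇒≤degree G {x} dom =
  injection⇒≤degree G (punchIn x) (Fin.punchIn-injective x _ _) λ i → dom (Fin.punchInᵢ≢i x i ∘ sym)

-- The leaf, u, v and the core are distinct. With m = p - 2 the bound is p + 1, which excludes K_p
-- minus an edge.
Bridge⇒order : (G : Graph n) {u v : Fin n} → u ≢ v → Bridge m G u v → 3 + m ≤ n
Bridge⇒order G u≢v B = Fin.injective⇒≤ (∷-injective
  (λ { zero → leaf≢u ; (suc zero) → leaf≢v ; (suc (suc i)) → leaf∉ i })
  (∷-injective (λ { zero → u≢v ; (suc i) → Adj⇒≢ G (u-core i) })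
    (∷-injective (λ i → Adj⇒≢ G (v-core i)) (Clique-injective G clique))))
  where open Bridge B

-- Once all cliques on 4 + r vertices are peeled off, only the last alternative
-- of Reduced.bridge is left.
module Remainder {r e : ℕ} (0<e : 0 < e) (G : Graph (3 + r + e))
                 (separated : ∀ x y → x ≡ y ⊎ Adj G x y ⊎ Bridge (2 + r) G x y) where

  open Bridge

  -- With p = 4 + r, `d` is p - 2 and the graph has 1 + d + e = p - 1 + e vertices.
  d : ℕ
  d = 2 + r

  hasBridge : ∀ x → (∃[ y ] Bridge d G x y) ⊎ (∀ {y} → x ≢ y → Adj G x y)
  hasBridge x = ⊎.map₂ (λ f {y} x≢y → [ (λ x≡y → contradiction x≡y x≢y) , id ]′ (f y)) (search sort)
    where
    sort : ∀ y → (∃[ y ] Bridge d G x y) ⊎ (x ≡ y ⊎ Adj G x y)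
    sort y with separated x y
    ... | inj₁ x≡y        = inj₂ (inj₁ x≡y)
    ... | inj₂ (inj₁ axy) = inj₂ (inj₂ axy)
    ... | inj₂ (inj₂ B)   = inj₁ (y , B)

  d≤degree : ∀ x → d ≤ degree G x
  d≤degree x with hasBridge x
  ... | inj₁ (_ , B) = injection⇒≤degree G (core B) (Clique-injective G (clique B)) (u-core B)
  ... | inj₂ dom     = ℕ.≤-trans (ℕ.m≤m+n d e) (dominating⇒≤degree G dom)

  module _ {v : Fin (1 + d + e)} (deg≤d : degree G v ≤ d) where
    neighbour∈core : ∀ {y} (B : Bridge d G v y) {x} → Adj G v x → ∃[ i ] x ≡ core B i
    neighbour∈core B = degree-exhausted G (core B) (Clique-injective G (clique B)) (u-core B) deg≤d

    -- The core of any bridge at v consists of d neighbours of v, hence of all of them. If y is not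
    -- adjacent to v, then x lies in the core of a bridge between v and y. If y is a neighbour too,
    -- some bridge at v exists, since v has too small a degree to be joined to all d + e other
    -- vertices, and its core is a clique containing x and y.
    neighbour-dominating : ∀ {x} → Adj G v x → ∀ {y} → x ≢ y → Adj G x y
    neighbour-dominating {x} avx {y} x≢y with separated v y
    ... | inj₁ refl = Adj-sym G avx
    ... | inj₂ (inj₂ B) with i , refl ← neighbour∈core B avx = Adj-sym G (v-core B i)
    ... | inj₂ (inj₁ avy) with hasBridge v
    ...   | inj₂ dom = contradiction (ℕ.≤-trans (dominating⇒≤degree G dom) deg≤d)
                         (ℕ.<⇒≱ (ℕ.m<m+n d 0<e))
    ...   | inj₁ (_ , B) with i , refl ← neighbour∈core B avx | j , refl ← neighbour∈core B avy
            = clique B (x≢y ∘ cong (core B))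

    -- The bound is the degree sum of K_d joined to 1 + e isolated vertices.
    degreeSum-join : (1 + d + e) * d + d * e ≤ degreeSum G
    degreeSum-join = begin
      (1 + d + e) * d + d * e
        ≤⟨ ℕ.+-monoʳ-≤ ((1 + d + e) * d) (ℕ.*-monoˡ-≤ e (d≤degree v)) ⟩
      (1 + d + e) * d + degree G v * e
        ≡⟨ cong₂ _+_ (sym (∑-const (1 + d + e) d)) (*-distribʳ-sum e (λ x → ⟦ adj G v x ⟧)) ⟩
      ∑[ x < 1 + d + e ] d + ∑[ x < 1 + d + e ] (⟦ adj G v x ⟧ * e)
        ≡⟨ ∑-distrib-+ (λ _ → d) (λ x → ⟦ adj G v x ⟧ * e) ⟨
      ∑[ x < 1 + d + e ] (d + ⟦ adj G v x ⟧ * e)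
        ≤⟨ ∑-mono bound ⟩
      degreeSum G ∎
      where
      open ℕ.≤-Reasoning

      bound : ∀ x → d + ⟦ adj G v x ⟧ * e ≤ degree G x
      bound x with adj G v x in eq
      ... | false = ℕ.≤-trans (ℕ.≤-reflexive (ℕ.+-identityʳ d)) (d≤degree x)
      ... | true  = ℕ.≤-trans (ℕ.≤-reflexive (cong (λ z → d + z) (ℕ.+-identityʳ e)))
                      (dominating⇒≤degree G (neighbour-dominating (subst T (sym eq) tt)))

  -- If G were regular of degree 1 + d, the neighbourhood of a core vertex κ
  -- would be the rest of the core together with u and v; a vertex outside it
  -- shares with κ two adjacent neighbours, which can only be u and v.
  ¬all-degree≤ : ∀ {u v} → ¬ Adj G u v → u ≢ v → Bridge d G u v → ¬ (∀ x → degree G x ≤ 1 + d)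
  ¬all-degree≤ {u} {v} ¬auv u≢v B deg≤ = go
    where
    κ : Fin d → Fin _
    κ = core B

    around : Fin d → Fin (1 + d) → Fin _
    around i = u ∷ v ∷ κ ∘ punchIn i

    around-inj : ∀ i → Injective _≡_ _≡_ (around i)
    around-inj i = ∷-injective (λ { zero → u≢v ; (suc j) → Adj⇒≢ G (u-core B _) })
      (∷-injective (λ j → Adj⇒≢ G (v-core B _))
        (Fin.punchIn-injective i _ _ ∘ Clique-injective G (clique B)))

    around-adj : ∀ i j → Adj G (κ i) (around i j)
    around-adj i = ∷-all {P = Adj G (κ i)} (Adj-sym G (u-core B i))
      (∷-all {P = Adj G (κ i)} (Adj-sym G (v-core B i)) λ j → clique B (Fin.punchInᵢ≢i i j ∘ sym))

    κ-neighbour : ∀ i {x} → Adj G (κ i) x → x ≡ u ⊎ x ≡ v ⊎ ∃[ j ] x ≡ κ j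
    κ-neighbour i aκx with degree-exhausted G (around i) (around-inj i) (around-adj i) (deg≤ (κ i)) aκx
    ... | zero        , eq = inj₁ eq
    ... | suc zero    , eq = inj₂ (inj₁ eq)
    ... | suc (suc j) , eq = inj₂ (inj₂ (punchIn i j , eq))

    ¬κ-leaf : ∀ i → ¬ Adj G (κ i) (leaf B)
    ¬κ-leaf i e with κ-neighbour i e
    ... | inj₁ eq              = leaf≢u B eq
    ... | inj₂ (inj₁ eq)       = leaf≢v B eq
    ... | inj₂ (inj₂ (j , eq)) = leaf∉ B j eq

    go : ⊥
    go with separated (κ zero) (leaf B)
    ... | inj₁ eq       = leaf∉ B zero (sym eq)
    ... | inj₂ (inj₁ e) = ¬κ-leaf zero e
    -- Two core vertices exist because d = 2 + r. Each is adjacent to the leaf of `B`, which no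
    -- vertex of `κ` is, so each must be u or v.
    ... | inj₂ (inj₂ D) = clash (core-D zero) (core-D (suc zero)) (clique D λ ())
      where
      core-D : ∀ i → core D i ≡ u ⊎ core D i ≡ v
      core-D i with κ-neighbour zero (u-core D i)
      ... | inj₁ eq              = inj₁ eq
      ... | inj₂ (inj₁ eq)       = inj₂ eq
      ... | inj₂ (inj₂ (j , eq)) = contradiction
              (Adj-sym G (subst (Adj G (leaf B)) eq (v-core D i))) (¬κ-leaf j)

      clash : ∀ {x y} → x ≡ u ⊎ x ≡ v → y ≡ u ⊎ y ≡ v → ¬ Adj G x y
      clash (inj₁ refl) (inj₁ refl) e = Adj⇒≢ G e refl
      clash (inj₁ refl) (inj₂ refl) e = ¬auv e
      clash (inj₂ refl) (inj₁ refl) e = ¬auv (Adj-sym G e)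
      clash (inj₂ refl) (inj₂ refl) e = Adj⇒≢ G e refl

  degreeSum-bound : ∀ {u v} → ¬ Adj G u v → u ≢ v → Bridge d G u v →
    (1 + d + e) * d + d * e ≤ degreeSum G ⊎ (1 + d + e) * (1 + d) < degreeSum G
  degreeSum-bound ¬auv u≢v B with any? (λ x → degree G x ℕ.≤? d)
  ... | yes (_ , deg≤) = inj₁ (degreeSum-join deg≤)
  ... | no  deg≰ with any? (λ x → suc d ℕ.<? degree G x)
  ...   | yes (x , deg>) = inj₂ (ℕ.≤-<-trans (ℕ.≤-reflexive (sym (∑-const (1 + d + e) (1 + d))))
            (∑-mono-< (λ y → ℕ.≰⇒> (λ deg≤ → deg≰ (y , deg≤))) x deg>))
  ...   | no  deg≯ = contradiction (λ x → ℕ.≮⇒≥ (λ deg> → deg≯ (x , deg>))) (¬all-degree≤ ¬auv u≢v B)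

-- Comparison with the disjoint union of cliques

degreeSum-canonical : ∀ q k a → degreeSum (q · K a ∪ K k) ≡ q * (a * pred a) + k * pred k
degreeSum-canonical q k a = trans (degreeSum-∪ (q · K a) (K k)) (cong₂ _+_ (copies q) (degreeSum-K k))
  where
  copies : ∀ q → degreeSum (q · K a) ≡ q * (a * pred a)
  copies zero    = refl
  copies (suc q) = trans (degreeSum-∪ (K a) (q · K a)) (cong₂ _+_ (degreeSum-K a) (copies q))

-- All degrees in the union of cliques are at most p - 1 = 1 + m; the right side is the degree sum
-- of a (p - 1)-regular graph of the same order.
canonical-≤-regular : ∀ q k m → k ≤ 1 + m →
  q * ((2 + m) * (1 + m)) + k * pred k ≤ (q * (2 + m) + k) * (1 + m)
canonical-≤-regular q k m k≤ = begin
  q * ((2 + m) * (1 + m)) + k * pred k   ≤⟨ ℕ.+-monoʳ-≤ _ (ℕ.*-monoʳ-≤ k (ℕ.≤-trans ℕ.pred[n]≤n k≤)) ⟩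
  q * ((2 + m) * (1 + m)) + k * (1 + m)  ≡⟨ cong (_+ k * (1 + m)) (ℕ.*-assoc q (2 + m) (1 + m)) ⟨
  q * (2 + m) * (1 + m) + k * (1 + m)    ≡⟨ ℕ.*-distribʳ-+ (1 + m) (q * (2 + m)) k ⟨
  (q * (2 + m) + k) * (1 + m)            ∎
  where open ℕ.≤-Reasoning

-- Turns a strict inequality into a polynomial identity for the ring solver, with the gap `suc d`
-- made explicit.
<-witness : ∀ {x y} d → x + suc d ≡ y → x < y
<-witness {x} d eq = ℕ.≤-trans (ℕ.m<m+n x (s≤s z≤n)) (ℕ.≤-reflexive eq)

order-suc : ∀ r q k → suc q * (4 + r) + k ≡ 3 + r + (1 + (q * (4 + r) + k))
order-suc = ℕSolver.solve-∀

canonical-<-join : ∀ q k r e → k ≤ 3 + r → 2 ≤ e → 3 + r + e ≡ q * (4 + r) + k →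
  q * ((4 + r) * (3 + r)) + k * pred k < (3 + r + e) * (2 + r) + (2 + r) * e
canonical-<-join zero k r e k≤ 2≤e eq =
  contradiction (ℕ.≤-trans (ℕ.≤-reflexive eq) k≤)
    (ℕ.<⇒≱ (ℕ.m<m+n (3 + r) (ℕ.≤-trans (s≤s z≤n) 2≤e)))
canonical-<-join (suc q) k r e k≤ 2≤e eq
  with refl ← ℕ.+-cancelˡ-≡ (3 + r) e (1 + (q * (4 + r) + k)) (trans eq (order-suc r q k))
  = go q k k≤ 2≤e
  where
  k≡0 : ∀ r q → suc (suc q) * ((4 + r) * (3 + r)) + 0 + suc (r * r + 5 * r + 1 + (r * r + 5 * r + 4) * q) ≡
        (3 + r + (1 + (suc q * (4 + r) + 0))) * (2 + r) + (2 + r) * (1 + (suc q * (4 + r) + 0))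
  k≡0 = ℕSolver.solve-∀

  k≡1 : ∀ r q → suc q * ((4 + r) * (3 + r)) + 1 * 0 + suc (r + r + 1 + (4 + r) * (1 + r) * q) ≡
        (3 + r + (1 + (q * (4 + r) + 1))) * (2 + r) + (2 + r) * (1 + (q * (4 + r) + 1))
  k≡1 = ℕSolver.solve-∀

  k≥2 : ∀ r q k → suc q * ((4 + r) * (3 + r)) + (2 + k) * (2 + r)
          + suc (r + r + 1 + k * (2 + r) + (4 + r) * (1 + r) * q) ≡
        (3 + r + (1 + (q * (4 + r) + (2 + k)))) * (2 + r) + (2 + r) * (1 + (q * (4 + r) + (2 + k)))
  k≥2 = ℕSolver.solve-∀

  go : ∀ q k → k ≤ 3 + r → 2 ≤ 1 + (q * (4 + r) + k) →
       suc q * ((4 + r) * (3 + r)) + k * pred k <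
       (3 + r + (1 + (q * (4 + r) + k))) * (2 + r) + (2 + r) * (1 + (q * (4 + r) + k))
  -- This is order p, where the inequality fails (K_p against K_p minus an edge); `2 ≤ e` excludes
  -- it.
  go zero    zero          _        (s≤s ())
  go (suc q) zero          _        _ = <-witness _ (k≡0 r q)
  -- Kept apart from k ≥ 2: the estimate `pred k ≤ 2 + r` used there would leave a gap of only r
  -- when k = 1 and q = 0, which is not positive for r = 0.
  go q       (suc zero)    _        _ = <-witness _ (k≡1 r q)
  go q       (suc (suc k)) (s≤s k≤) _ = ℕ.≤-<-trans
    (ℕ.+-monoʳ-≤ (suc q * ((4 + r) * (3 + r))) (ℕ.*-monoʳ-≤ (2 + k) k≤)) (<-witness _ (k≥2 r q k))

-- Classification of reduced graphs

module _ {r : ℕ} (G : Graph n) (red : Reduced (2 + r) G) where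
  open Reduced red

  private
    HasClique NonadjacentBridge : Set
    HasClique = Σ[ g ∈ (Fin (4 + r) → Fin n) ] Clique G g
    NonadjacentBridge = ∃[ u ] ∃[ v ] u ≢ v × ¬ Adj G u v × Bridge (2 + r) G u v

    Separated Complete : Set
    Separated = ∀ x y → x ≡ y ⊎ Adj G x y ⊎ Bridge (2 + r) G x y
    Complete = ∀ {x y} → x ≢ y → Adj G x y

  -- This does not decide whether a K_p exists: a clique is reported only when some nonadjacent pair
  -- runs into one. Otherwise `Separated` holds, which is what the analysis of the remainder
  -- consumes.
  cliqueOrSeparated : HasClique ⊎ Separated
  cliqueOrSeparated = search λ x → search λ y → sort x y
    where
    sort : ∀ x y → HasClique ⊎ (x ≡ y ⊎ Adj G x y ⊎ Bridge (2 + r) G x y)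
    sort x y with x ≟ y | T? (adj G x y)
    ... | yes x≡y | _       = inj₂ (inj₁ x≡y)
    ... | no  _   | yes axy = inj₂ (inj₂ (inj₁ axy))
    ... | no  x≢y | no ¬axy with bridge x≢y ¬axy
    ...   | inj₁ (g , clique , _)        = inj₁ (g , clique)
    ...   | inj₂ (inj₁ (g , clique , _)) = inj₁ (g , clique)
    ...   | inj₂ (inj₂ B)                = inj₂ (inj₂ (inj₂ B))

  bridgeOrComplete : Separated → NonadjacentBridge ⊎ Complete
  bridgeOrComplete separated =
    ⊎.map₂ (λ f {x} {y} x≢y → [ (λ x≡y → contradiction x≡y x≢y) , id ]′ (f x y))
      (search λ x → search λ y → sort x y)
    where
    sort : ∀ x y → NonadjacentBridge ⊎ (x ≡ y ⊎ Adj G x y)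
    sort x y with x ≟ y | T? (adj G x y)
    ... | yes x≡y | _       = inj₂ (inj₁ x≡y)
    ... | no  _   | yes axy = inj₂ (inj₂ axy)
    ... | no  x≢y | no ¬axy with separated x y
    ...   | inj₁ x≡y        = contradiction x≡y x≢y
    ...   | inj₂ (inj₁ axy) = contradiction axy ¬axy
    ...   | inj₂ (inj₂ B)   = inj₁ (x , y , x≢y , ¬axy , B)

  trichotomy : HasClique ⊎ (Separated × NonadjacentBridge) ⊎ (Complete × n < 4 + r)
  trichotomy with cliqueOrSeparated
  ... | inj₁ C         = inj₁ C
  ... | inj₂ separated with bridgeOrComplete separated
  ...   | inj₁ N        = inj₂ (inj₁ (separated , N))
  ...   | inj₂ complete with (4 + r) ℕ.≤? n
  ...     | yes p≤n = inj₁ ((λ i → inject≤ i p≤n) , λ i≢j → complete (i≢j ∘ Fin.inject≤-injective p≤n p≤n _ _))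
  ...     | no  p≰n = inj₂ (inj₂ (complete , ℕ.≰⇒> p≰n))

remainder-bound : ∀ {r} q k (G : Graph n) → n ≡ q * (4 + r) + k → k ≤ 3 + r →
  (∀ x y → x ≡ y ⊎ Adj G x y ⊎ Bridge (2 + r) G x y) →
  ∀ {u v} → u ≢ v → ¬ Adj G u v → Bridge (2 + r) G u v →
  degreeSum (q · K (4 + r) ∪ K k) < degreeSum G
remainder-bound {r = r} q k G n≡ k≤ separated u≢v ¬auv B
  -- The order is at least p + 1 = 5 + r; written as 3 + r + e, this gives e ≥ 2.
  with 5+r≤n ← Bridge⇒order G u≢v B
  with e , refl ← ℕ.m≤n⇒∃[o]m+o≡n (ℕ.≤-trans (ℕ.m≤n+m (3 + r) 2) 5+r≤n)
  with 2≤e ← ℕ.+-cancelˡ-≤ (3 + r) 2 e (ℕ.≤-trans (ℕ.≤-reflexive (ℕ.+-comm (3 + r) 2)) 5+r≤n)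
  rewrite degreeSum-canonical q k (4 + r)
  with Remainder.degreeSum-bound (ℕ.≤-trans (s≤s z≤n) 2≤e) G separated ¬auv u≢v B
... | inj₁ join≤    = ℕ.<-≤-trans (canonical-<-join q k r e k≤ 2≤e n≡) join≤
... | inj₂ regular< = ℕ.≤-<-trans (canonical-≤-regular q k (2 + r) k≤)
                        (subst (λ x → x * (3 + r) < degreeSum G) n≡ regular<)

prepend-clique : ∀ q k (G : Graph n) (H : Graph b) → G ≅ K a ∪ H →
  H ≅ q · K a ∪ K k ⊎ degreeSum (q · K a ∪ K k) < degreeSum H →
  G ≅ suc q · K a ∪ K k ⊎ degreeSum (suc q · K a ∪ K k) < degreeSum G
prepend-clique {a = a} q k G H iso = ⊎.map
  (λ iso′ → ≅-trans G (K a ∪ H) C′ iso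
    (≅-trans (K a ∪ H) (K a ∪ C) C′ (∪-congʳ (K a) H C iso′) (∪-assoc (K a) (q · K a) (K k))))
  (subst₂ _<_
    (trans (sym (degreeSum-∪ (K a) C)) (degreeSum-≅ (K a ∪ C) C′ (∪-assoc (K a) (q · K a) (K k))))
    (trans (sym (degreeSum-∪ (K a) H)) (sym (degreeSum-≅ G (K a ∪ H) iso)))
    ∘ ℕ.+-monoʳ-< (degreeSum (K a)))
  where
  C  = q · K a ∪ K k
  C′ = suc q · K a ∪ K k

-- Induction on `q`, one peeled clique per step; both alternatives survive putting the clique back
-- because degree sums are additive. For `zero` the order k is too small for a K_p, and for `suc q`
-- the order is at least p, so a complete graph below p is impossible.
classify : ∀ {r} q k (G : Graph n) → n ≡ q * (4 + r) + k → k ≤ 3 + r → Reduced (2 + r) G →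
  G ≅ q · K (4 + r) ∪ K k ⊎ degreeSum (q · K (4 + r) ∪ K k) < degreeSum G
classify q k G n≡ k≤ red with trichotomy G red
classify q k G n≡ k≤ red | inj₂ (inj₁ (separated , _ , _ , u≢v , ¬auv , B)) =
  inj₂ (remainder-bound q k G n≡ k≤ separated u≢v ¬auv B)
classify zero k G refl k≤ red | inj₂ (inj₂ (complete , _)) = inj₁ (≅-K complete)
  where
  ≅-K : (∀ {x y} → x ≢ y → Adj G x y) → G ≅ K 0 ∪ K k
  ≅-K complete = ↔-id _ , eq
    where
    eq : ∀ x y → adj G x y ≡ adj (K k) x y
    eq x y with x ≟ y
    ... | yes refl = adj-irrefl G x
    ... | no  x≢y  = Equivalence.to T-≡ (complete x≢y)
classify {r = r} (suc q) k G refl k≤ red | inj₂ (inj₂ (_ , n<p)) =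
  contradiction (ℕ.≤-trans (ℕ.m≤m+n (4 + r) _) (ℕ.m≤m+n _ k)) (ℕ.<⇒≱ n<p)
classify zero k G refl k≤ red | inj₁ (g , clique) =
  contradiction (Fin.injective⇒≤ (Clique-injective G {g} clique)) (ℕ.<⇒≱ (s≤s k≤))
classify {r = r} (suc q) k G n≡ k≤ red | inj₁ (g , clique)
  with b , b+p≡n , G′ , iso , red′ ← peel G red g clique
  = prepend-clique q k G G′ iso
      (classify q k G′ (ℕ.+-cancelˡ-≡ (4 + r) b _ (trans b+p≡n (trans n≡ (ℕ.+-assoc (4 + r) _ k)))) k≤ red′)

-- From degree sums to edge counts and the closed formula

double-cancel-≤ : ∀ {x y} → x + x ≤ y + y → x ≤ y
double-cancel-≤ x+x≤y+y = ℕ.≮⇒≥ λ y<x → ℕ.<⇒≱ (ℕ.+-mono-< y<x y<x) x+x≤y+y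

size-mono : {G : Graph m} {H : Graph n} → degreeSum G ≤ degreeSum H → size G ≤ size H
size-mono {G = G} {H} le = double-cancel-≤ (subst₂ _≤_ (sym (handshake G)) (sym (handshake H)) le)

-- The two halves need not be integers separately. In unnormalised rationals the equation is a cross
-- multiplication, with 4 the unreduced denominator of the sum.
halves : ∀ (s : ℕ) (x y : ℤ) → + s ℤ.+ + s ≡ x ℤ.+ y → + s ℚ./ 1 ≡ x ℚ./ 2 ℚ.+ y ℚ./ 2
halves s x y eq = ℚ.toℚᵘ-injective (begin
  ℚ.toℚᵘ (+ s ℚ./ 1)                          ≈⟨ ℚ.toℚᵘ-fromℚᵘ (ℚᵘ.mkℚᵘ (+ s) 0) ⟩
  ℚᵘ.mkℚᵘ (+ s) 0                             ≈⟨ ℚᵘ.*≡* cross ⟩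
  ℚᵘ.mkℚᵘ x 1 ℚᵘ.+ ℚᵘ.mkℚᵘ y 1                ≈⟨ ℚᵘ.+-cong (ℚ.toℚᵘ-fromℚᵘ (ℚᵘ.mkℚᵘ x 1)) (ℚ.toℚᵘ-fromℚᵘ (ℚᵘ.mkℚᵘ y 1)) ⟨
  ℚ.toℚᵘ (x ℚ./ 2) ℚᵘ.+ ℚ.toℚᵘ (y ℚ./ 2)      ≈⟨ ℚ.toℚᵘ-homo-+ (x ℚ./ 2) (y ℚ./ 2) ⟨
  ℚ.toℚᵘ (x ℚ./ 2 ℚ.+ y ℚ./ 2)                ∎)
  where
  open ℚᵘ.≃-Reasoning

  double : ∀ z → z ℤ.* + 4 ≡ (z ℤ.+ z) ℤ.* + 2
  double = ℤSolver.solve-∀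

  expand : ∀ x y → (x ℤ.+ y) ℤ.* + 2 ≡ (x ℤ.* + 2 ℤ.+ y ℤ.* + 2) ℤ.* + 1
  expand = ℤSolver.solve-∀

  cross : + s ℤ.* + 4 ≡ (x ℤ.* + 2 ℤ.+ y ℤ.* + 2) ℤ.* + 1
  cross = trans (double (+ s)) (trans (cong (ℤ._* + 2) eq) (expand x y))

-- Here `p` is one less than the clique order. Adding and removing k replaces the truncated
-- `k * pred k` by k² - k, uniformly for k = 0; the rest is a ring identity.
canonical-size : ∀ q k p s → s + s ≡ q * (suc p * p) + k * pred k →
  + s ℤ.+ + s ≡ (+ suc p ℤ.- + 1) ℤ.* + (q * suc p + k) ℤ.+ + k ℤ.* (+ k ℤ.- + suc p)
canonical-size q k p s eq = begin
  + s ℤ.+ + s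
    ≡⟨ cancel (+ s) (+ k) ⟩
  + (s + s + k) ℤ.- + k
    ≡⟨ cong (λ z → + z ℤ.- + k) (trans (cong (_+ k) eq)
         (trans (ℕ.+-assoc (q * (suc p * p)) _ k) (cong (λ z → q * (suc p * p) + z) (square k)))) ⟩
  + (q * (suc p * p) + k * k) ℤ.- + k
    ≡⟨ cong (ℤ._- + k) (trans (ℤ.pos-+ (q * (suc p * p)) (k * k))
         (cong₂ ℤ._+_ (trans (ℤ.pos-* q (suc p * p)) (cong (+ q ℤ.*_) (ℤ.pos-* (suc p) p))) (ℤ.pos-* k k))) ⟩
  (+ q ℤ.* ((+ 1 ℤ.+ + p) ℤ.* + p) ℤ.+ + k ℤ.* + k) ℤ.- + k
    ≡⟨ rearrange (+ q) (+ p) (+ k) ⟩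
  ((+ 1 ℤ.+ + p) ℤ.- + 1) ℤ.* (+ q ℤ.* (+ 1 ℤ.+ + p) ℤ.+ + k) ℤ.+ + k ℤ.* (+ k ℤ.- (+ 1 ℤ.+ + p))
    ≡⟨ cong (λ z → (+ suc p ℤ.- + 1) ℤ.* (z ℤ.+ + k) ℤ.+ + k ℤ.* (+ k ℤ.- + suc p)) (ℤ.pos-* q (suc p)) ⟨
  (+ suc p ℤ.- + 1) ℤ.* + (q * suc p + k) ℤ.+ + k ℤ.* (+ k ℤ.- + suc p) ∎
  where
  open ≡-Reasoning

  cancel : ∀ x y → x ℤ.+ x ≡ (x ℤ.+ x ℤ.+ y) ℤ.- y
  cancel = ℤSolver.solve-∀

  rearrange : ∀ q p k → (q ℤ.* ((+ 1 ℤ.+ p) ℤ.* p) ℤ.+ k ℤ.* k) ℤ.- k ≡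
    ((+ 1 ℤ.+ p) ℤ.- + 1) ℤ.* (q ℤ.* (+ 1 ℤ.+ p) ℤ.+ k) ℤ.+ k ℤ.* (k ℤ.- (+ 1 ℤ.+ p))
  rearrange = ℤSolver.solve-∀

  square : ∀ k → k * pred k + k ≡ k * k
  square zero    = refl
  square (suc k) = trans (ℕ.+-comm (suc k * k) (suc k)) (sym (ℕ.*-suc (suc k) k))

module Extremal (r q k n : ℕ) (k≤ : k ≤ 3 + r) (n≡ : n ≡ q * (4 + r) + k) where
  F : Graph (1 + (3 + r + 1))
  F = K 1 ∨ (K (3 + r) ∪ K 1)

  canonical : Graph (q * (4 + r) + k)
  canonical = q · K (4 + r) ∪ K k

  -- The order of `canonical` equals n only propositionally. Transporting the graph together with
  -- its isomorphism avoids computing with a transported adjacency.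
  canonical-representative : ∃[ G ] (_≅_ {n} G canonical)
  canonical-representative = subst (λ n → Σ[ G ∈ Graph n ] G ≅ canonical) (sym n≡) (canonical , ≅-refl canonical)

  representative : Graph n
  representative = proj₁ canonical-representative

  representative≅ : representative ≅ canonical
  representative≅ = proj₂ canonical-representative

  classify-saturated : (G : Graph n) → Saturated F G → G ≅ canonical ⊎ degreeSum canonical < degreeSum G
  classify-saturated G sat = classify q k G n≡ k≤ (Saturated⇒Reduced G sat)

  ≅⇒Saturated : (G : Graph n) → G ≅ canonical → Saturated F G
  ≅⇒Saturated G iso = Packed⇒Saturated G
    (Packed-≅ {H = canonical} iso (Packed-canonical q (ℕ.≤-trans k≤ (ℕ.n≤1+n _))))

  ≅⇒IsSat : (G : Graph n) → G ≅ canonical → IsSat n F (size G)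
  ≅⇒IsSat G iso = (G , ≅⇒Saturated G iso , refl) , λ H sat → size-mono {G = G} {H} (
    ℕ.≤-trans (ℕ.≤-reflexive (degreeSum-≅ G canonical iso))
      ([ (λ iso′ → ℕ.≤-reflexive (sym (degreeSum-≅ H canonical iso′))) , ℕ.<⇒≤ ]′ (classify-saturated H sat)))

  SAT⇔≅ : ∀ (G : Graph n) → G ∈ SAT n F ⇔ G ≅ canonical
  SAT⇔≅ G = mk⇔
    (λ (sat , _ , minimal) → [ id , (λ lt → contradiction
        (subst₂ _≤_ (handshake G)
          (trans (handshake representative) (degreeSum-≅ representative canonical representative≅))
          (let le = minimal representative (≅⇒Saturated representative representative≅) in ℕ.+-mono-≤ le le))
        (ℕ.<⇒≱ lt)) ]′ (classify-saturated G sat))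
    (λ iso → ≅⇒Saturated G iso , ≅⇒IsSat G iso)

  size-representative : size representative + size representative ≡ q * ((4 + r) * (3 + r)) + k * pred k
  size-representative = trans (handshake representative)
    (trans (degreeSum-≅ representative canonical representative≅) (degreeSum-canonical q k (4 + r)))

theorem1p2 : ∀ (p k n : ℕ) .{{_ : NonZero p}} →
    4 ≤ p → k ≤ p ∸ 1 → p ℕ.+ 1 ≤ n → n % p ≡ k % p →
    let F = K 1 ∨ (K (p ∸ 1) ∪ K 1) in
    (∃[ s ] (IsSat n F s ×
    + s ℚ./ 1 ≡ ((+ p ℤ.- + 1) ℤ.* + n) ℚ./ 2 ℚ.+ (+ k ℤ.* (+ k ℤ.- + p)) ℚ./ 2))
    × (∀ (G : Graph n) → G ∈ SAT n F ⇔ G ≅ ((n ℕ./ p) · K p ∪ K k))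
theorem1p2 p@(suc (suc (suc (suc r)))) k n (s≤s (s≤s (s≤s (s≤s z≤n)))) k≤ _ n%p≡k%p =
  (size representative , ≅⇒IsSat representative representative≅ ,
    halves (size representative) ((+ p ℤ.- + 1) ℤ.* + n) (+ k ℤ.* (+ k ℤ.- + p))
      (trans (canonical-size q k (3 + r) (size representative) size-representative)
        (cong (λ z → (+ p ℤ.- + 1) ℤ.* + z ℤ.+ + k ℤ.* (+ k ℤ.- + p)) (sym n≡))))
  , SAT⇔≅
  where
  q : ℕ
  q = n ℕ./ p

  -- Since k < p, the residue `k % p` is k itself, so k is the remainder of n.
  n≡ : n ≡ q * p + k
  n≡ = trans (m≡m%n+[m/n]*n n p) (trans (ℕ.+-comm (n % p) _)
    (cong (λ z → q * p + z) (trans n%p≡k%p (m<n⇒m%n≡m (s≤s k≤)))))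

  open Extremal r q k n k≤ n≡
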